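{- For integers $\ell\geq r\geq 3$ and $1\leq k<\frac{\ell^2-1}{2}$, and sufficiently large $n$, $$\mathrm{ex}^{\sum}_r(n,k,K_\ell^{(r)+})= \min\left\{k,\binom{\ell}{2}-1\right\}\binom{n}{r}.$$
   Context: An $r$-graph is an $r$-uniform hypergraph. For a graph $F$, the $r$-expansion $F^{(r)+}$ is the $r$-graph obtained from $F$ by adding, for each edge of $F$, $r-2$ new vertices to that edge, all new vertices being distinct from each other and from $V(F)$; $K_\ell$ is the complete graph on $\ell$ vertices. Given $r$-graphs $\mathcal{H}_1,\dots,\mathcal{H}_k$ on a common vertex set, they contain a rainbow copy of an $r$-graph $\mathcal{F}$ if their union contains a copy of $\mathcal{F}$ whose hyperedges can be assigned to pairwise distinct indices $i$ with each hyperedge belonging to the corresponding $\mathcal{H}_i$. The rainbow hyper-Turán number $\mathrm{ex}^{\sum}_r(n,k,\mathcal{F})$ is the maximum of $\sum_{i=1}^k e(\mathcal{H}_i)$ over all $k$-tuples of $r$-graphs $\mathcal{H}_1,\dots,\mathcal{H}_k$ on the same $n$-vertex set containing no rainbow copy of $\mathcal{F}$. -}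

module Defs where

open import Data.Nat using (ℕ; _+_; _*_; _∸_; _<_; _≤_; _⊓_)
open import Data.Nat.Combinatorics using (_C_)
open import Data.Fin using (Fin) renaming (_<_ to _<ᶠ_)
open import Data.Fin.Subset using (Subset; ∣_∣) renaming (_∈_ to _∈ₛ_)
open import Data.List using (List; length; map; allFin)
open import Data.Nat.ListAction using (sum)
open import Data.List.Membership.Propositional using (_∈_)
open import Data.List.Relation.Unary.All using (All)
open import Data.List.Relation.Unary.Unique.Propositional using (Unique)
open import Data.Product using (Σ; ∃; _×_; _,_; proj₁)
open import Data.Sum using (_⊎_; inj₁; inj₂)
open import Relation.Binary.PropositionalEquality using (_≡_)
open import Function.Bundles using (_⇔_)
open import Relation.Nullary using (¬_)

record RGraph (r n : ℕ) : Set where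
  field
    edges   : List (Subset n)
    unique  : Unique edges
    uniform : All (λ e → ∣ e ∣ ≡ r) edges
open RGraph public

e : ∀ {r n} → RGraph r n → ℕ
e H = length (edges H)

-- edges of K_ℓ : pairs (a , b) with a < b
Pair : ℕ → Set
Pair ℓ = Σ (Fin ℓ × Fin ℓ) (λ ab → proj₁ ab <ᶠ Data.Product.proj₂ ab)

-- vertex set of the expansion K_ℓ^{(r)+}: the ℓ core vertices, plus
-- r-2 new vertices for every edge of K_ℓ
ExpVertex : ℕ → ℕ → Set
ExpVertex r ℓ = Fin ℓ ⊎ (Pair ℓ × Fin (r ∸ 2))

InExpEdge : ∀ {r ℓ} → Pair ℓ → ExpVertex r ℓ → Set
InExpEdge ((a , b) , _) (inj₁ x) = (x ≡ a) ⊎ (x ≡ b)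
InExpEdge p (inj₂ (q , _)) = proj₁ q ≡ proj₁ p

RainbowExpansionK : (r ℓ : ℕ) {n k : ℕ} → (Fin k → RGraph r n) → Set
RainbowExpansionK r ℓ {n} {k} H =
  Σ (ExpVertex r ℓ → Fin n) λ φ →
  Σ (Pair ℓ → Fin k) λ c →
    (∀ x y → φ x ≡ φ y → x ≡ y)
  × (∀ p q → c p ≡ c q → proj₁ p ≡ proj₁ q)
  × (∀ p → Σ (Subset n) λ s → s ∈ edges (H (c p))
        × (∀ v → (v ∈ₛ s) ⇔ (Σ (ExpVertex r ℓ) λ x → InExpEdge {r} {ℓ} p x × φ x ≡ v)))

sumEdges : ∀ {r n k} → (Fin k → RGraph r n) → ℕ
sumEdges {k = k} H = sum (map (λ i → e (H i)) (allFin k))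

{-# OPTIONS --safe #-}
module Submission where

-- Fix a copy of the expansion of K_N inside [n] for a constant N and average over all permutations
-- of [n]: if ∑ e(H_i) > (m − 1)·C(n,r) with m = C(ℓ,2), some permuted copy has total weight
-- more than (m − 1)·C(N,2), where the weight of a core pair is the number of colours containing
-- its r-edge. This reduces the theorem to a weighted graph on the N core vertices.
-- There, repeatedly deleting a vertex of degree below (m − 1)(n′ − 1) increases the excess weight, so
-- the process stops while the graph is still large. Now an edge of weight ≥ m is
-- extended to an ℓ-clique one vertex at a time, each new vertex sending weight at least s(m − 1) to
-- the s previous ones. With g = k − m, the hypothesis 2k < ℓ² − 1 forces every clique edge to have
-- weight ≥ g, and the total weight exceeds (m − 1)m; if j edges had weight ≤ t < j then, as
-- t ≥ g, the total would be at most jt + (m − j)(m + g) ≤ (m − 1)m. Hence Hall's condition holds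
-- in the strong form under which colours can be chosen greedily.
-- Throughout, c stands for m − 1, so that k = suc c + g.

open import Algebra.Properties.CommutativeSemigroup using (interchange)
open import Defs
open import Data.Nat
open import Data.Nat.Properties
open import Data.Nat.Combinatorics using (_C_; nCk+nC[k+1]≡[n+1]C[k+1]; nC1≡n)
open import Data.Nat.ListAction using (sum)
open import Data.Nat.ListAction.Properties using (sum-++; sum-↭)
open import Data.Nat.Solver using (module +-*-Solver)
open import Data.Bool as Bool using (true; false; if_then_else_; T)
open import Data.Empty using () renaming (⊥ to Empty)
open import Data.Fin using (Fin; zero; suc; toℕ; inject≤; join; combine; splitAt; punchIn; punchOut) renaming (_<_ to _<ᶠ_)
open import Data.Fin.Properties as Fin
  using (inject≤-injective; combine-injective; splitAt-join; punchIn-injective; punchInᵢ≢i; punchIn-punchOut)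
open import Data.Fin.Subset using (Subset; inside; outside; ∣_∣; ⊥) renaming (_∈_ to _∈ₛ_; _∉_ to _∉ₛ_)
open import Data.Fin.Subset.Properties using (∉⊥; ∣⊥∣≡0; ∣p∣≤n)
open import Data.List using (List; []; _∷_; [_]; _++_; map; length; allFin; filter; foldr; lookup; tabulate; upTo; cartesianProductWith)
open import Data.List.Properties
  using (length-++; length-map; length-filter; length-tabulate; length-upTo; map-++; map-∘; map-tabulate; ++-identityʳ)
import Data.List.Membership.DecPropositional as DecMembership
open import Data.List.Membership.Propositional using (_∈_; _∉_; find; lose)
open import Data.List.Membership.Propositional.Properties
  using (∈-∃++; ∈-++⁺ˡ; ∈-++⁺ʳ; ∈-++⁻; ∈-map⁺; ∈-map⁻; ∈-filter⁺; ∈-filter⁻; ∈-allFin; ∈-upTo⁺; ∈-lookup)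
open import Data.List.Relation.Binary.Permutation.Propositional as Perm
  using (_↭_; prep; swap; ↭-refl; ↭-sym; ↭-trans; ↭⇒↭ₛ)
open import Data.List.Relation.Binary.Permutation.Propositional.Properties using (↭-length; map⁺; ∈-resp-↭; shift; ++⁺ˡ)
open import Data.List.Relation.Binary.Permutation.Setoid.Properties using (Unique-resp-↭)
open import Data.List.Relation.Unary.All as All using (All; []; _∷_)
import Data.List.Relation.Unary.All.Properties as All
open import Data.List.Relation.Unary.AllPairs using (AllPairs; []; _∷_)
open import Data.List.Relation.Unary.Any using (here; there; any?)
open import Data.List.Relation.Unary.Unique.Propositional using (Unique)
import Data.List.Relation.Unary.Unique.Propositional.Properties as Unique
open import Data.Product as Product using (Σ; ∃; ∃₂; _×_; _,_; proj₁; proj₂; uncurry)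
open import Data.Product.Properties using (,-injective) renaming (≡-dec to ×-≡-dec)
open import Data.Sum as Sum using (_⊎_; inj₁; inj₂)
open import Data.Sum.Properties using (inj₁-injective; inj₂-injective)
open import Data.Vec as Vec using (Vec; []; _∷_; insertAt; _[_]≔_; here; there)
open import Data.Vec.Properties
  using (insertAt-lookup; insertAt-punchIn; []=⇒lookup; lookup⇒[]=; []≔-updates; []≔-minimal; lookup∘update′; ≡-dec)
open import Function using (_∘_; id; _⇔_; mk⇔; Equivalence)
open import Relation.Binary.Definitions using (DecidableEquality; tri<; tri≈; tri>)
open import Relation.Binary.PropositionalEquality
  using (_≡_; _≢_; refl; sym; trans; cong; cong₂; subst; subst₂; setoid; module ≡-Reasoning)
open import Relation.Nullary using (yes; no; ¬_; contradiction; ¬?; Dec; does)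
open import Relation.Nullary.Decidable using (decidable-stable)
open +-*-Solver using (solve; _:=_; _:+_; _:*_; con)

-- Sums over lists, rearrangements of lists, and pairs of list entries.

private variable
  A B D : Set
  n r : ℕ

∑ : List A → (A → ℕ) → ℕ
∑ xs f = sum (map f xs)

∑-++ : ∀ (xs ys : List A) f → ∑ (xs ++ ys) f ≡ ∑ xs f + ∑ ys f
∑-++ xs ys f = trans (cong sum (map-++ f xs ys)) (sum-++ (map f xs) (map f ys))

∑-↭ : ∀ {xs ys : List A} f → xs ↭ ys → ∑ xs f ≡ ∑ ys f
∑-↭ f p = sum-↭ (map⁺ f p)

∑-cong : ∀ (xs : List A) {f g} → (∀ x → f x ≡ g x) → ∑ xs f ≡ ∑ xs g
∑-cong []       eq = refl
∑-cong (x ∷ xs) eq = cong₂ _+_ (eq x) (∑-cong xs eq)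

∑-mono : ∀ (xs : List A) {f g} → (∀ {x} → x ∈ xs → f x ≤ g x) → ∑ xs f ≤ ∑ xs g
∑-mono []       le = z≤n
∑-mono (x ∷ xs) le = +-mono-≤ (le (here refl)) (∑-mono xs (le ∘ there))

∑-const : ∀ (xs : List A) c → ∑ xs (λ _ → c) ≡ length xs * c
∑-const []       c = refl
∑-const (x ∷ xs) c = cong (c +_) (∑-const xs c)

∑-≤ : ∀ {f : A → ℕ} {c} xs → (∀ {x} → x ∈ xs → f x ≤ c) → ∑ xs f ≤ length xs * c
∑-≤ {c = c} xs le = ≤-trans (∑-mono xs le) (≤-reflexive (∑-const xs c))

∑-≥ : ∀ {f : A → ℕ} {c} xs → (∀ {x} → x ∈ xs → c ≤ f x) → length xs * c ≤ ∑ xs f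
∑-≥ {c = c} xs le = ≤-trans (≤-reflexive (sym (∑-const xs c))) (∑-mono xs le)

∑-+ : ∀ (xs : List A) f g → ∑ xs (λ x → f x + g x) ≡ ∑ xs f + ∑ xs g
∑-+ []       f g = refl
∑-+ (x ∷ xs) f g = trans (cong ((f x + g x) +_) (∑-+ xs f g)) (interchange +-commutativeSemigroup (f x) (g x) _ _)

∑-*ˡ : ∀ (xs : List A) c f → ∑ xs (λ x → c * f x) ≡ c * ∑ xs f
∑-*ˡ []       c f = sym (*-zeroʳ c)
∑-*ˡ (x ∷ xs) c f = trans (cong (c * f x +_) (∑-*ˡ xs c f)) (sym (*-distribˡ-+ c (f x) _))

∑-swap : ∀ (xs : List A) (ys : List B) (f : A → B → ℕ) →
         ∑ xs (λ x → ∑ ys (f x)) ≡ ∑ ys (λ y → ∑ xs (λ x → f x y))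
∑-swap []       ys f = sym (trans (∑-const ys 0) (*-zeroʳ (length ys)))
∑-swap (x ∷ xs) ys f =
  trans (cong (∑ ys (f x) +_) (∑-swap xs ys f)) (sym (∑-+ ys (f x) _))

∑-map : ∀ (h : B → A) (xs : List B) (f : A → ℕ) → ∑ (map h xs) f ≡ ∑ xs (f ∘ h)
∑-map h xs f = cong sum (sym (map-∘ xs))

-- A head of value at most `c` can be cancelled together with its share of the bound, so the strict
-- excess passes to the tail. The remaining entries are returned as well, so that a chosen vertex
-- can be removed from the candidates.
∑-pigeonhole : ∀ c (xs : List A) f → length xs * c < ∑ xs f →
               ∃₂ λ x rest → xs ↭ x ∷ rest × c < f x
∑-pigeonhole c (x ∷ xs) f lt with c <? f x
... | yes c<fx = x , xs , ↭-refl , c<fx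
... | no  c≮fx with ∑-pigeonhole c xs f (+-cancelˡ-< c _ _ (<-≤-trans lt (+-monoˡ-≤ _ (≮⇒≥ c≮fx))))
... | y , rest , p , c<fy = y , x ∷ rest , ↭-trans (prep x p) (swap x y ↭-refl) , c<fy

∈⇒↭∷ : ∀ {x : A} {xs} → x ∈ xs → ∃ λ rest → xs ↭ x ∷ rest
∈⇒↭∷ {x = x} x∈xs with ∈-∃++ x∈xs
... | ys , zs , refl = ys ++ zs , shift x ys zs

unique⊆⇒length≤ : ∀ {xs ys : List A} → Unique xs → (∀ {x} → x ∈ xs → x ∈ ys) → length xs ≤ length ys
unique⊆⇒length≤ {xs = []}     _        _   = z≤n
unique⊆⇒length≤ {xs = x ∷ xs} {ys} (x∉ ∷ u) sub with ∈⇒↭∷ (sub (here refl))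
... | rest , p = ≤-trans (s≤s (unique⊆⇒length≤ u sub′)) (≤-reflexive (sym (↭-length p)))
  where
  sub′ : ∀ {y} → y ∈ xs → y ∈ rest
  sub′ y∈ with ∈-resp-↭ p (sub (there y∈))
  ... | here eq = contradiction (sym eq) (All.lookup x∉ y∈)
  ... | there z = z

maximum : (f : A → ℕ) (x : A) (xs : List A) →
          ∃₂ λ y rest → (x ∷ xs) ↭ y ∷ rest × (∀ {z} → z ∈ rest → f z ≤ f y)
maximum f x [] = x , [] , ↭-refl , λ ()
maximum f x (x′ ∷ xs) with maximum f x′ xs
... | y , rest , p , max with f x ≤? f y
... | yes fx≤fy = y , x ∷ rest , ↭-trans (prep x p) (swap x y ↭-refl) ,
                  λ { (here refl) → fx≤fy ; (there z∈) → max z∈ }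
... | no  fx≰fy = x , y ∷ rest , prep x p ,
                  λ { (here refl) → ≰⇒≥ fx≰fy ; (there z∈) → ≤-trans (max z∈) (≰⇒≥ fx≰fy) }

-- This is C(n,2), with the recursion that `pairs` follows; `tri≡C2` links it to `_C_`.
tri : ℕ → ℕ
tri zero    = 0
tri (suc n) = n + tri n

unique-↭ : {xs ys : List A} → xs ↭ ys → Unique xs → Unique ys
unique-↭ p = Unique-resp-↭ (setoid _) (↭⇒↭ₛ p)

unique-++ˡ : ∀ (xs : List A) {ys} → Unique (xs ++ ys) → Unique xs
unique-++ˡ []       _        = []
unique-++ˡ (x ∷ xs) (x∉ ∷ u) = All.++⁻ˡ xs x∉ ∷ unique-++ˡ xs u

pairs : List A → List (A × A)
pairs []       = []
pairs (x ∷ xs) = map (x ,_) xs ++ pairs xs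

length-pairs : ∀ (xs : List A) → length (pairs xs) ≡ tri (length xs)
length-pairs []       = refl
length-pairs (x ∷ xs) = trans (length-++ (map (x ,_) xs)) (cong₂ _+_ (length-map _ xs) (length-pairs xs))

weight : (A → A → ℕ) → List A → ℕ
weight w xs = ∑ (pairs xs) (uncurry w)

weight-∷ : ∀ (w : A → A → ℕ) x xs → weight w (x ∷ xs) ≡ ∑ xs (w x) + weight w xs
weight-∷ w x xs = trans (∑-++ (map (x ,_) xs) (pairs xs) (uncurry w)) (cong (_+ weight w xs) (∑-map (x ,_) xs (uncurry w)))

-- Weighted graphs: deletion of low-degree vertices and growth of a clique.

module WeightedGraph {A : Set} (w : A → A → ℕ) (w-sym : ∀ x y → w x y ≡ w y x)
                     (c k : ℕ) (w≤k : ∀ x y → w x y ≤ k) where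

  deg : A → List A → ℕ
  deg x xs = ∑ xs (w x)

  weight-↭ : ∀ {xs ys} → xs ↭ ys → weight w xs ≡ weight w ys
  weight-↭ Perm.refl = refl
  weight-↭ (prep {xs} {ys} x p)
    rewrite weight-∷ w x xs | weight-∷ w x ys = cong₂ _+_ (∑-↭ (w x) p) (weight-↭ p)
  weight-↭ (swap {xs} {ys} x y p)
    rewrite weight-∷ w x (y ∷ xs) | weight-∷ w y xs | weight-∷ w y (x ∷ ys) | weight-∷ w x ys
          | w-sym x y | ∑-↭ (w x) p | ∑-↭ (w y) p | weight-↭ p =
    interchange +-commutativeSemigroup (w y x) (deg x ys) (deg y ys) (weight w ys)
  weight-↭ (Perm.trans p q) = trans (weight-↭ p) (weight-↭ q)

  weight≤ : ∀ xs → weight w xs ≤ tri (length xs) * k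
  weight≤ xs = ≤-trans (∑-≤ (pairs xs) (λ _ → w≤k _ _)) (≤-reflexive (cong (_* k) (length-pairs xs)))

  -- The summand w x x cancels the diagonal term of deg x xs.
  Dense : List A → Set
  Dense xs = ∀ {x} → x ∈ xs → pred (length xs) * c + w x x ≤ deg x xs

  -- Deleting a vertex that violates density raises the excess weight − tri · c by at least one; hence
  -- t, a lower bound for excess plus number of vertices, survives every deletion.
  prune : ∀ d t xs → length xs ≡ d → Unique xs →
          tri (length xs) * c + t ≤ weight w xs + length xs →
          ∃ λ ys → Unique ys × Dense ys × length ys ≤ length xs × tri (length ys) * c + t ≤ weight w ys + length ys
  prune d t xs eq u le with any? (λ x → deg x xs <? pred (length xs) * c + w x x) xs
  ... | no  none = xs , u , (λ x∈ → ≮⇒≥ (λ lt → none (lose x∈ lt))) , ≤-refl , le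
  ... | yes some with find some
  ... | x , x∈ , lt with ∈⇒↭∷ x∈
  prune zero    t []       eq   u le | yes some | x , () , lt | rest , p
  prune (suc d) t xs       eq   u le | yes some | x , x∈ , lt | rest , p
    rewrite ↭-length p | ∑-↭ (w x) p | weight-↭ p | weight-∷ w x rest
    with unique-↭ p u
  ... | _ ∷ u′ with prune d t rest (suc-injective eq) u′ (+-cancelˡ-≤ (suc (deg x rest)) _ _ le′)
    where
    small : suc (deg x rest) ≤ length rest * c
    small = +-cancelˡ-< (w x x) _ _ (subst (w x x + deg x rest <_) (+-comm _ (w x x)) lt)
    open ≤-Reasoning
    le′ : suc (deg x rest) + (tri (length rest) * c + t) ≤ suc (deg x rest) + (weight w rest + length rest)
    le′ = begin
      suc (deg x rest) + (tri (length rest) * c + t)            ≤⟨ +-monoˡ-≤ _ small ⟩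
      length rest * c + (tri (length rest) * c + t)             ≡⟨ solve 4 (λ r q c t → r :* c :+ (q :* c :+ t) := (r :+ q) :* c :+ t) refl (length rest) (tri (length rest)) c t ⟩
      (length rest + tri (length rest)) * c + t                 ≤⟨ le ⟩
      deg x rest + weight w rest + suc (length rest)            ≡⟨ solve 3 (λ a b l → a :+ b :+ (con 1 :+ l) := con 1 :+ a :+ (b :+ l)) refl (deg x rest) (weight w rest) (length rest) ⟩
      suc (deg x rest) + (weight w rest + length rest)          ∎
  ... | ys , uys , dense , short , le″ = ys , uys , dense , m≤n⇒m≤1+n short , le″

  -- Vertices are peeled off in list order. If the first one sends more than `c` on average to the
  -- later ones, pigeonhole gives the edge; otherwise its removal costs at most `length xs * c` and
  -- the excess survives.
  heavyEdge : ∀ xs → tri (length xs) * c < weight w xs →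
              ∃₂ λ x y → ∃ λ rest → xs ↭ x ∷ y ∷ rest × c < w x y
  heavyEdge (x ∷ xs) lt rewrite weight-∷ w x xs with length xs * c <? deg x xs
  ... | yes h with ∑-pigeonhole c xs (w x) h
  ... | y , rest , p , c<w = x , y , rest , prep x p , c<w
  heavyEdge (x ∷ xs) lt | no h with heavyEdge xs (+-cancelˡ-< (length xs * c) _ _
      (<-≤-trans (subst (_< deg x xs + weight w xs) (*-distribʳ-+ c (length xs) _) lt) (+-monoˡ-≤ _ (≮⇒≥ h))))
  ... | y , z , rest , p , c<w =
    y , z , x ∷ rest , ↭-trans (prep x p) (↭-trans (swap x y ↭-refl) (prep y (swap x z ↭-refl))) , c<w

  -- By `room`, if a new vertex sends total weight at least `suc s * c` to `suc s` clique vertices,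
  -- and at most `k` to each, then it sends at least `g` to each.
  module Grow (ℓ g : ℕ) (c>0 : 0 < c) (room : ∀ s → suc s < ℓ → g + s * k ≤ suc s * c) where

    record Clique (ys : List A) (s : ℕ) : Set where
      field
        vs rest : List A
        split   : ys ↭ vs ++ rest
        size    : length vs ≡ s
        edges≥g : AllPairs (λ x y → g ≤ w x y) vs
        heavy   : tri s * c < weight w vs

    bigSum⇒all≥ : ∀ (xs : List A) f → (∀ x → f x ≤ k) → g + pred (length xs) * k ≤ ∑ xs f → All (λ x → g ≤ f x) xs
    bigSum⇒all≥ xs f f≤k le = All.tabulate λ {x} x∈ → bound x x∈
      where
      open ≤-Reasoning
      bound : ∀ x → x ∈ xs → g ≤ f x
      bound x x∈ with ∈⇒↭∷ x∈
      ... | rest , p = +-cancelʳ-≤ (length rest * k) _ _ (begin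
        g + length rest * k         ≡⟨ cong (λ n → g + pred n * k) (↭-length p) ⟨
        g + pred (length xs) * k    ≤⟨ le ⟩
        ∑ xs f                      ≡⟨ ∑-↭ f p ⟩
        f x + ∑ rest f              ≤⟨ +-monoʳ-≤ (f x) (∑-≤ rest (λ _ → f≤k _)) ⟩
        f x + length rest * k       ∎)

    -- Density bounds the degree of each clique vertex in `ys` from below. Summing over the `S`
    -- clique vertices and swapping the sums, the vertices of `rest` send to the clique at least
    -- `S * c` on average, up to a total loss of `S * (S * k)` for weights within `vs`. As `rest`
    -- has more vertices than that, the loss is below one per vertex, and by integrality some vertex
    -- sends at least `S * c`.
    extend : ∀ {ys s} → Dense ys → ℓ + ℓ * (ℓ * k) < length ys → suc s < ℓ →
             Clique ys (suc s) → Clique ys (suc (suc s))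
    extend {ys} {s} dense big s<ℓ K = record
      { vs = x ∷ vs ; rest = rest′
      ; split = ↭-trans split (↭-trans (++⁺ˡ vs p) (shift x vs rest′))
      ; size = cong suc size
      ; edges≥g = bigSum⇒all≥ vs (w x) (w≤k x) (subst (λ n → g + pred n * k ≤ deg x vs) (sym size) (≤-trans (room s s<ℓ) deg≥)) ∷ edges≥g
      ; heavy = subst (tri (suc (suc s)) * c <_) (sym (weight-∷ w x vs))
                  (subst (_< deg x vs + weight w vs) (sym (*-distribʳ-+ c (suc s) _)) (+-mono-≤-< deg≥ heavy)) }
      where
      open Clique K
      open ≤-Reasoning
      S = suc s
      -- Pigeonhole gives a strict inequality, so it is applied to `S * c` less one; `c>0` makes
      -- this a true predecessor.
      q = pred (S * c)
      sc≡ : S * c ≡ suc q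
      sc≡ = sym (suc-pred (S * c) {{>-nonZero (≤-trans c>0 (m≤m+n c _))}})
      len : length ys ≡ S + length rest
      len = trans (↭-length split) (trans (length-++ vs) (cong (_+ length rest) size))
      Sℓ : S ≤ ℓ
      Sℓ = <⇒≤ s<ℓ
      restBig : S * (S * k) < length rest
      restBig = +-cancelˡ-< S _ _ (begin-strict
        S + S * (S * k)    ≤⟨ +-mono-≤ Sℓ (*-mono-≤ Sℓ (*-monoˡ-≤ k Sℓ)) ⟩
        ℓ + ℓ * (ℓ * k)    <⟨ big ⟩
        length ys          ≡⟨ len ⟩
        S + length rest    ∎)
      toRest : ∀ {v} → v ∈ vs → length rest * c ≤ deg v rest + S * k
      toRest {v} v∈ = begin
        length rest * c                        ≤⟨ *-monoˡ-≤ c (m≤n+m _ s) ⟩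
        (s + length rest) * c                  ≡⟨ cong (λ n → pred n * c) len ⟨
        pred (length ys) * c                   ≤⟨ m≤m+n _ (w v v) ⟩
        pred (length ys) * c + w v v           ≤⟨ dense (∈-resp-↭ (↭-sym split) (∈-++⁺ˡ v∈)) ⟩
        deg v ys                               ≡⟨ ∑-↭ (w v) split ⟩
        deg v (vs ++ rest)                     ≡⟨ ∑-++ vs rest (w v) ⟩
        deg v vs + deg v rest                  ≤⟨ +-monoˡ-≤ _ (∑-≤ vs (λ _ → w≤k v _)) ⟩
        length vs * k + deg v rest             ≡⟨ cong (λ n → n * k + deg v rest) size ⟩
        S * k + deg v rest                     ≡⟨ +-comm (S * k) _ ⟩
        deg v rest + S * k                     ∎
      total : length rest * q < ∑ rest (λ x → ∑ vs (λ v → w v x))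
      total = +-cancelʳ-< (length rest) _ _ (begin-strict
        length rest * q + length rest                         ≡⟨ solve 2 (λ r q → r :* q :+ r := r :* (con 1 :+ q)) refl (length rest) q ⟩
        length rest * suc q                                   ≡⟨ cong (length rest *_) sc≡ ⟨
        length rest * (S * c)                                 ≡⟨ solve 3 (λ r s c → r :* (s :* c) := s :* (r :* c)) refl (length rest) S c ⟩
        S * (length rest * c)                                 ≡⟨ cong (_* (length rest * c)) size ⟨
        length vs * (length rest * c)                         ≤⟨ ∑-≥ vs toRest ⟩
        ∑ vs (λ v → deg v rest + S * k)                       ≡⟨ ∑-+ vs (λ v → deg v rest) (λ _ → S * k) ⟩
        ∑ vs (λ v → deg v rest) + ∑ vs (λ _ → S * k)          ≡⟨ cong₂ _+_ (∑-swap vs rest w) (trans (∑-const vs (S * k)) (cong (_* (S * k)) size)) ⟩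
        ∑ rest (λ x → ∑ vs (λ v → w v x)) + S * (S * k)       <⟨ +-monoʳ-< _ restBig ⟩
        ∑ rest (λ x → ∑ vs (λ v → w v x)) + length rest       ∎)
      new = ∑-pigeonhole q rest (λ x → ∑ vs (λ v → w v x)) total
      x = proj₁ new
      rest′ = proj₁ (proj₂ new)
      p = proj₁ (proj₂ (proj₂ new))
      deg≥ : S * c ≤ deg x vs
      deg≥ = begin
        S * c                      ≡⟨ sc≡ ⟩
        suc q                      ≤⟨ proj₂ (proj₂ (proj₂ new)) ⟩
        ∑ vs (λ v → w v x)         ≡⟨ ∑-cong vs (λ v → w-sym v x) ⟩
        deg x vs                   ∎

    clique : ∀ {ys} → Dense ys → ℓ + ℓ * (ℓ * k) < length ys → g ≤ c →
             tri (length ys) * c < weight w ys → ∀ s → suc (suc s) ≤ ℓ → Clique ys (suc (suc s))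
    clique dense big g≤c heavy (suc s) s<ℓ =
      extend dense big s<ℓ (clique dense big g≤c heavy s (<⇒≤ s<ℓ))
    -- The initial edge has weight above `c`, and `g ≤ c` makes it meet the lower bound required of
    -- clique edges.
    clique {ys} dense big g≤c heavy zero s<ℓ with heavyEdge ys heavy
    ... | x , y , rest , p , c<w = record
      { vs = x ∷ y ∷ [] ; rest = rest ; split = p ; size = refl
      ; edges≥g = (≤-trans g≤c (<⇒≤ c<w) ∷ []) ∷ [] ∷ []
      ; heavy = subst (_< w x y + 0) (sym (+-identityʳ c)) (subst (c <_) (sym (+-identityʳ _)) c<w) }

    HeavyClique : Set
    HeavyClique = ∃ λ vs → Unique vs × length vs ≡ ℓ × AllPairs (λ x y → g ≤ w x y) vs × tri ℓ * c < weight w vs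

    -- Pruning leaves some `ys` for which `suc (length xs)` is at most
    -- `tri (length ys) * k + length ys`. Were `ys` to have at most `M` vertices, this would
    -- contradict the length of `xs`; so `ys` is long enough for `extend` at every stage up to `ℓ`.
    heavyClique : ∀ xs → Unique xs → 2 ≤ ℓ → g ≤ c → tri (length xs) * c < weight w xs →
      let M = ℓ + ℓ * (ℓ * k) in M + tri M * k ≤ length xs →
      HeavyClique
    heavyClique xs u 2≤ℓ g≤c lt long
      with prune (length xs) (suc (length xs)) xs refl u
             -- The initial excess is at least one, so `t` can be `suc (length xs)`. This exceeds
             -- `length ys`, which keeps the excess of `ys` positive in `lt′`.
             (subst (_≤ weight w xs + length xs) (sym (+-suc _ _)) (+-monoˡ-≤ (length xs) lt))
    ... | ys , u′ , dense , short , le = finish ℓ 2≤ℓ refl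
      where
      open ≤-Reasoning
      M = ℓ + ℓ * (ℓ * k)
      tri-mono : ∀ {a b} → a ≤ b → tri a ≤ tri b
      tri-mono z≤n       = z≤n
      tri-mono (s≤s a≤b) = +-mono-≤ a≤b (tri-mono a≤b)
      bound : suc (length xs) ≤ tri (length ys) * k + length ys
      bound = begin
        suc (length xs)                              ≤⟨ m≤n+m _ (tri (length ys) * c) ⟩
        tri (length ys) * c + suc (length xs)        ≤⟨ le ⟩
        weight w ys + length ys                      ≤⟨ +-monoˡ-≤ _ (weight≤ ys) ⟩
        tri (length ys) * k + length ys              ∎
      big : M < length ys
      big = ≰⇒> λ few → <-irrefl refl (begin-strict
        length xs                          <⟨ bound ⟩
        tri (length ys) * k + length ys    ≤⟨ +-mono-≤ (*-monoˡ-≤ k (tri-mono few)) few ⟩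
        tri M * k + M                      ≡⟨ +-comm _ M ⟩
        M + tri M * k                      ≤⟨ long ⟩
        length xs                          ∎)
      lt′ : tri (length ys) * c < weight w ys
      lt′ = +-cancelʳ-< (length ys) _ _ (<-≤-trans (+-monoʳ-< _ (s≤s short)) le)
      finish : ∀ n → 2 ≤ n → n ≡ ℓ → HeavyClique
      finish (suc (suc s)) (s≤s (s≤s z≤n)) refl with clique dense big g≤c lt′ s ≤-refl
      ... | K = Clique.vs K , unique-++ˡ (Clique.vs K) (unique-↭ (Clique.split K) u′) , Clique.size K , Clique.edges≥g K , Clique.heavy K

-- Distinct colours from Hall's condition.

-- Hall's condition in the form used by the greedy choice, which colours elements by increasing f.
Hall : {A : Set} → (A → ℕ) → List A → Set
Hall f xs = ∀ {x ys zs} → xs ↭ (x ∷ ys) ++ zs → (∀ {y} → y ∈ ys → f y ≤ f x) → length (x ∷ ys) ≤ f x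

hall : {A : Set} (f : A → ℕ) (c g : ℕ) (xs : List A) → length xs ≡ suc c →
       (∀ {x} → x ∈ xs → g ≤ f x) → (∀ x → f x ≤ suc c + g) → suc c * c < ∑ xs f → Hall f xs
hall f c g xs len low high heavy {x} {ys} {zs} p max = ≮⇒≥ λ t<j → <⇒≱ heavy (begin
    ∑ xs f                                   ≡⟨ ∑-↭ f p ⟩
    ∑ ((x ∷ ys) ++ zs) f                     ≡⟨ ∑-++ (x ∷ ys) zs f ⟩
    ∑ (x ∷ ys) f + ∑ zs f                    ≤⟨ +-mono-≤ (∑-≤ (x ∷ ys) (λ { (here refl) → ≤-refl ; (there y∈) → max y∈ })) (∑-≤ zs (λ _ → high _)) ⟩
    -- Raising `g` to `t` lets the terms combine: with `j + z` equal to `suc c`, the bound becomes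
    -- `(t + z) * suc c`, and `t < j` gives `t + z ≤ c`.
    j * t + z * (suc c + g)                  ≤⟨ +-monoʳ-≤ (j * t) (*-monoʳ-≤ z (+-monoʳ-≤ (suc c) (low (∈-resp-↭ (↭-sym p) (here refl))))) ⟩
    j * t + z * (suc c + t)                  ≡⟨ solve 4 (λ j t z m → j :* t :+ z :* (m :+ t) := t :* (j :+ z) :+ z :* m) refl j t z (suc c) ⟩
    t * (j + z) + z * suc c                  ≡⟨ cong (λ m → t * m + z * suc c) sizes ⟩
    t * suc c + z * suc c                    ≡⟨ *-distribʳ-+ (suc c) t z ⟨
    (t + z) * suc c                          ≤⟨ *-monoˡ-≤ (suc c) (≤-pred (≤-trans (+-monoˡ-≤ z t<j) (≤-reflexive sizes))) ⟩
    c * suc c                                ≡⟨ *-comm c (suc c) ⟩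
    suc c * c                                ∎)
  where
  open ≤-Reasoning
  t = f x
  j = length (x ∷ ys)
  z = length zs
  sizes : j + z ≡ suc c
  sizes = trans (sym (length-++ (x ∷ ys))) (trans (sym (↭-length p)) len)

module _ {A B : Set} (_≟ᴬ_ : DecidableEquality A) (_≟ᴮ_ : DecidableEquality B) where

  open DecMembership _≟ᴮ_ using () renaming (_∈?_ to _∈ᴮ?_)

  fresh : ∀ {xs ys : List B} → Unique xs → length ys < length xs → ∃ λ x → x ∈ xs × x ∉ ys
  fresh {xs} {ys} u lt with any? (λ x → ¬? (x ∈ᴮ? ys)) xs
  ... | yes some = find some
  ... | no  none = contradiction
    (unique⊆⇒length≤ u (λ {x} x∈ → decidable-stable (x ∈ᴮ? ys) (λ x∉ → none (lose x∈ x∉)))) (<⇒≱ lt)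

  -- An element `x` with the longest list is coloured last. Hall's condition passes to the other
  -- elements, since `x` can be put into the complement `zs`. Applied to the whole list, it says
  -- that `L x` is longer than the list of colours already used, so a fresh one remains. The default
  -- `b` is the colour of elements outside the list.
  greedySDR : (L : A → List B) → (∀ x → Unique (L x)) → B → ∀ n xs → length xs ≡ n → Hall (length ∘ L) xs →
              ∃ λ (c : A → B) → (∀ {x} → x ∈ xs → c x ∈ L x) ×
                                (∀ {x y} → x ∈ xs → y ∈ xs → c x ≡ c y → x ≡ y)
  greedySDR L u b n       []       eq   h = (λ _ → b) , (λ ()) , λ ()
  greedySDR L u b (suc n) (x₀ ∷ xs₀) eq h with maximum (length ∘ L) x₀ xs₀
  ... | x , xs , p , max
    with greedySDR L u b n xs (suc-injective (trans (sym (↭-length p)) eq))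
           (λ {y} {ys} {zs} q → h (↭-trans p (↭-trans (prep x q) (↭-sym (shift x (y ∷ ys) zs)))))
  ... | c , c∈L , c-inj
    with fresh {ys = map c xs} (u x) (subst (_< length (L x)) (sym (length-map c xs))
           (h (subst ((x₀ ∷ xs₀) ↭_) (sym (++-identityʳ (x ∷ xs))) p) max))
  ... | b′ , b′∈L , b′∉ = c′ , c′∈L ∘ ∈-resp-↭ p , λ y∈ z∈ → c′-inj (∈-resp-↭ p y∈) (∈-resp-↭ p z∈)
    where
    c′ : A → B
    c′ y with y ≟ᴬ x
    ... | yes _ = b′
    ... | no  _ = c y
    tail∈ : ∀ {y} → y ∈ x ∷ xs → ¬ (y ≡ x) → y ∈ xs
    tail∈ (here eq)  y≢x = contradiction eq y≢x
    tail∈ (there y∈) _   = y∈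
    c′∈L : ∀ {y} → y ∈ x ∷ xs → c′ y ∈ L y
    c′∈L {y} y∈ with y ≟ᴬ x
    ... | yes refl = b′∈L
    ... | no  y≢x  = c∈L (tail∈ y∈ y≢x)
    c′-inj : ∀ {y z} → y ∈ x ∷ xs → z ∈ x ∷ xs → c′ y ≡ c′ z → y ≡ z
    c′-inj {y} {z} y∈ z∈ eq with y ≟ᴬ x | z ≟ᴬ x
    ... | yes y≡x | yes z≡x = trans y≡x (sym z≡x)
    ... | no  y≢x | no  z≢x = c-inj (tail∈ y∈ y≢x) (tail∈ z∈ z≢x) eq
    ... | yes _   | no  z≢x = contradiction (subst (_∈ map c xs) (sym eq) (∈-map⁺ c (tail∈ z∈ z≢x))) b′∉
    ... | no  y≢x | yes _   = contradiction (subst (_∈ map c xs) eq (∈-map⁺ c (tail∈ y∈ y≢x))) b′∉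

  heavySDR : (L : A → List B) → (∀ x → Unique (L x)) → B → ∀ c g xs → length xs ≡ suc c →
             (∀ {x} → x ∈ xs → g ≤ length (L x)) → (∀ x → length (L x) ≤ suc c + g) →
             suc c * c < ∑ xs (length ∘ L) →
             ∃ λ (f : A → B) → (∀ {x} → x ∈ xs → f x ∈ L x) ×
                               (∀ {x y} → x ∈ xs → y ∈ xs → f x ≡ f y → x ≡ y)
  heavySDR L u b c g xs len low high heavy =
    greedySDR L u b (length xs) xs refl (hall (length ∘ L) c g xs len low high heavy)

-- Subsets of a given size and insertion of one coordinate.

∑-cartesian : (h : A → B → D) (xs : List A) (ys : List B) (f : D → ℕ) →
              ∑ (cartesianProductWith h xs ys) f ≡ ∑ xs (λ x → ∑ ys (λ y → f (h x y)))
∑-cartesian h []       ys f = refl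
∑-cartesian h (x ∷ xs) ys f = trans (∑-++ (map (h x) ys) _ f)
  (cong₂ _+_ (∑-map (h x) ys f) (∑-cartesian h xs ys f))

∑-allFin-suc : ∀ n (f : Fin (suc n) → ℕ) → ∑ (allFin (suc n)) f ≡ f zero + ∑ (allFin n) (f ∘ suc)
∑-allFin-suc n f = cong (λ xs → f zero + sum xs)
  (trans (map-tabulate suc f) (sym (map-tabulate id (f ∘ suc))))

subsets : ∀ n → ℕ → List (Subset n)
subsets zero    zero    = [ [] ]
subsets zero    (suc r) = []
subsets (suc n) zero    = map (outside ∷_) (subsets n zero)
subsets (suc n) (suc r) = map (inside ∷_) (subsets n r) ++ map (outside ∷_) (subsets n (suc r))

subsets-empty : ∀ n r → n < r → subsets n r ≡ []
subsets-empty zero    (suc r) _         = refl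
subsets-empty (suc n) (suc r) (s≤s n<r)
  rewrite subsets-empty n r n<r | subsets-empty n (suc r) (m≤n⇒m≤1+n n<r) = refl

length-subsets : ∀ n r → length (subsets n r) ≡ n C r
length-subsets zero    zero    = refl
length-subsets zero    (suc r) = refl
length-subsets (suc n) zero    = trans (length-map _ (subsets n zero)) (length-subsets n zero)
length-subsets (suc n) (suc r) = begin
  length (subsets (suc n) (suc r))
    ≡⟨ length-++ (map (inside ∷_) (subsets n r)) ⟩
  length (map (inside ∷_) (subsets n r)) + length (map (outside ∷_) (subsets n (suc r)))
    ≡⟨ cong₂ _+_ (trans (length-map _ (subsets n r)) (length-subsets n r))
                 (trans (length-map _ (subsets n (suc r))) (length-subsets n (suc r))) ⟩
  n C r + n C suc r
    ≡⟨ nCk+nC[k+1]≡[n+1]C[k+1] n r ⟩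
  suc n C suc r ∎
  where open ≡-Reasoning

∈-subsets : (p : Subset n) → p ∈ subsets n ∣ p ∣
∈-subsets []            = here refl
∈-subsets (inside  ∷ p) = ∈-++⁺ˡ (∈-map⁺ (inside ∷_) (∈-subsets p))
∈-subsets {n = suc n} (outside ∷ p) with ∣ p ∣ | ∈-subsets p
... | zero  | p∈ = ∈-map⁺ (outside ∷_) p∈
... | suc r | p∈ = ∈-++⁺ʳ (map (inside ∷_) (subsets n r)) (∈-map⁺ (outside ∷_) p∈)

∣subsets∣ : ∀ n r {p} → p ∈ subsets n r → ∣ p ∣ ≡ r
∣subsets∣ zero    zero    (here refl) = refl
∣subsets∣ (suc n) zero    p∈ with ∈-map⁻ _ p∈
... | q , q∈ , refl = ∣subsets∣ n zero q∈
∣subsets∣ (suc n) (suc r) p∈ with ∈-++⁻ (map (inside ∷_) (subsets n r)) p∈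
... | inj₁ p∈ˡ with ∈-map⁻ _ p∈ˡ
... | q , q∈ , refl = cong suc (∣subsets∣ n r q∈)
∣subsets∣ (suc n) (suc r) p∈ | inj₂ p∈ʳ with ∈-map⁻ _ p∈ʳ
... | q , q∈ , refl = ∣subsets∣ n (suc r) q∈

unique-subsets : ∀ n r → Unique (subsets n r)
unique-subsets zero    zero    = [] ∷ []
unique-subsets zero    (suc r) = []
unique-subsets (suc n) zero    = Unique.map⁺ (λ { refl → refl }) (unique-subsets n zero)
unique-subsets (suc n) (suc r) = Unique.++⁺
  (Unique.map⁺ (λ { refl → refl }) (unique-subsets n r))
  (Unique.map⁺ (λ { refl → refl }) (unique-subsets n (suc r)))
  λ (p∈ˡ , p∈ʳ) → case (∈-map⁻ _ p∈ˡ) (∈-map⁻ _ p∈ʳ)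
  where
  case : ∀ {p} → (∃ λ q → q ∈ subsets n r × p ≡ inside ∷ q) →
         (∃ λ q → q ∈ subsets n (suc r) × p ≡ outside ∷ q) → Empty
  case (_ , _ , refl) (_ , _ , ())

∑-subsets-suc : ∀ n r f → ∑ (subsets (suc n) (suc r)) f ≡
                ∑ (subsets n r) (f ∘ (inside ∷_)) + ∑ (subsets n (suc r)) (f ∘ (outside ∷_))
∑-subsets-suc n r f = trans (∑-++ (map (inside ∷_) (subsets n r)) _ f)
  (cong₂ _+_ (∑-map _ (subsets n r) f) (∑-map _ (subsets n (suc r)) f))

-- This is the inductive step of summing over permutations: the entry `b` takes every position among
-- coordinates that already run through all subsets of size `r`.
insertions : ∀ n r b (f : Subset (suc n) → ℕ) → ℕ
insertions n r b f = ∑ (allFin (suc n)) (λ i → ∑ (subsets n r) (λ p → f (insertAt p i b)))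

insertions-zero : ∀ n b f → insertions (suc n) zero b f ≡
  ∑ (subsets (suc n) zero) (f ∘ (b ∷_)) + insertions n zero b (f ∘ (outside ∷_))
insertions-zero n b f = trans (∑-allFin-suc (suc n) (λ i → ∑ (subsets (suc n) zero) (λ p → f (insertAt p i b)))) (cong (∑ (subsets (suc n) zero) (f ∘ (b ∷_)) +_)
  (∑-cong (allFin (suc n)) λ i → ∑-map (outside ∷_) (subsets n zero) (λ p → f (insertAt p (suc i) b))))

insertions-suc : ∀ n r b f → insertions (suc n) (suc r) b f ≡
  ∑ (subsets (suc n) (suc r)) (f ∘ (b ∷_)) +
  (insertions n r b (f ∘ (inside ∷_)) + insertions n (suc r) b (f ∘ (outside ∷_)))
insertions-suc n r b f = trans (∑-allFin-suc (suc n) (λ i → ∑ (subsets (suc n) (suc r)) (λ p → f (insertAt p i b)))) (cong (∑ (subsets (suc n) (suc r)) (f ∘ (b ∷_)) +_)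
  (trans (∑-cong (allFin (suc n)) λ i → ∑-subsets-suc n r (λ p → f (insertAt p (suc i) b)))
    (∑-+ (allFin (suc n)) (λ i → ∑ (subsets n r) (λ p → f (ins i (inside ∷ p)))) (λ i → ∑ (subsets n (suc r)) (λ p → f (ins i (outside ∷ p)))))))
  where
  ins : Fin (suc n) → Subset (suc n) → Subset (suc (suc n))
  ins i p = insertAt p (suc i) b

-- Each subset of size `suc r` arises once for every element whose coordinate may have been the
-- inserted one. The induction separates insertion at the front from the rest.
insertions-inside : ∀ n r f → insertions n r inside f ≡ suc r * ∑ (subsets (suc n) (suc r)) f
insertions-inside zero    zero    f = refl
insertions-inside zero    (suc r) f = sym (*-zeroʳ (suc (suc r)))
insertions-inside (suc n) zero    f
  rewrite insertions-zero n inside f | insertions-inside n zero (f ∘ (outside ∷_))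
        | ∑-subsets-suc (suc n) zero f =
  solve 2 (λ a b → a :+ con 1 :* b := con 1 :* (a :+ b)) refl (∑ (subsets (suc n) zero) (f ∘ (inside ∷_))) (∑ (subsets (suc n) 1) (f ∘ (outside ∷_)))
insertions-inside (suc n) (suc r) f
  rewrite insertions-suc n r inside f | insertions-inside n r (f ∘ (inside ∷_))
        | insertions-inside n (suc r) (f ∘ (outside ∷_)) | ∑-subsets-suc (suc n) (suc r) f =
  solve 3 (λ r a b → a :+ ((con 1 :+ r) :* a :+ (con 2 :+ r) :* b) := (con 2 :+ r) :* (a :+ b)) refl r
    (∑ (subsets (suc n) (suc r)) (f ∘ (inside ∷_))) (∑ (subsets (suc n) (suc (suc r))) (f ∘ (outside ∷_)))

-- Here the inserted coordinate is a non-element, and a subset of size `r` of `Fin (suc n)` has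
-- `suc n ∸ r` of them.
insertions-outside : ∀ n r f → insertions n r outside f ≡ (suc n ∸ r) * ∑ (subsets (suc n) r) f
insertions-outside zero    zero    f = refl
insertions-outside zero    (suc r) f = cong (_* ∑ (subsets 1 (suc r)) f) (sym (0∸n≡0 r))
insertions-outside (suc n) zero    f
  rewrite insertions-zero n outside f | insertions-outside n zero (f ∘ (outside ∷_))
        | ∑-map (outside ∷_) (subsets (suc n) zero) f = refl
insertions-outside (suc n) (suc r) f
  rewrite insertions-suc n r outside f | insertions-outside n r (f ∘ (inside ∷_))
        | insertions-outside n (suc r) (f ∘ (outside ∷_)) | ∑-subsets-suc (suc n) r f
  with r ≤? n
... | yes r≤n rewrite +-∸-assoc 1 r≤n =
  solve 3 (λ d a b → b :+ ((con 1 :+ d) :* a :+ d :* b) := (con 1 :+ d) :* (a :+ b)) refl (n ∸ r)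
    (∑ (subsets (suc n) r) (f ∘ (inside ∷_))) (∑ (subsets (suc n) (suc r)) (f ∘ (outside ∷_)))
-- Truncated subtraction breaks `suc n ∸ r ≡ suc (n ∸ r)` here, but there are no subsets of size
-- `suc r`, so the affected sum is zero.
... | no  r≰n rewrite subsets-empty (suc n) (suc r) (s≤s (≰⇒> r≰n)) =
  solve 3 (λ d e a → d :* a :+ e :* con 0 := d :* (a :+ con 0)) refl (suc n ∸ r) (n ∸ r)
    (∑ (subsets (suc n) r) (f ∘ (inside ∷_)))

-- Permutations and averaging over them.

-- A permutation of Fin n, given as the successive positions at which the entries of a vector are
-- inserted into its already permuted tail.
data Shuffle : ℕ → Set where
  []  : Shuffle 0
  _∷_ : Fin (suc n) → Shuffle n → Shuffle (suc n)

shuffles : ∀ n → List (Shuffle n)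
shuffles zero    = [ [] ]
shuffles (suc n) = cartesianProductWith _∷_ (allFin (suc n)) (shuffles n)

act : Shuffle n → Vec A n → Vec A n
act []      []       = []
act (i ∷ σ) (x ∷ xs) = insertAt (act σ xs) i x

pos : Shuffle n → Fin n → Fin n
pos (i ∷ σ) zero    = i
pos (i ∷ σ) (suc j) = punchIn i (pos σ j)

lookup-act : ∀ (σ : Shuffle n) (xs : Vec A n) j → Vec.lookup (act σ xs) (pos σ j) ≡ Vec.lookup xs j
lookup-act (i ∷ σ) (x ∷ xs) zero    = insertAt-lookup (act σ xs) i x
lookup-act (i ∷ σ) (x ∷ xs) (suc j) = trans (insertAt-punchIn (act σ xs) i x (pos σ j)) (lookup-act σ xs j)

pos-injective : ∀ (σ : Shuffle n) i j → pos σ i ≡ pos σ j → i ≡ j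
pos-injective (k ∷ σ) zero    zero    eq = refl
pos-injective (k ∷ σ) zero    (suc j) eq = contradiction (sym eq) (punchInᵢ≢i k _)
pos-injective (k ∷ σ) (suc i) zero    eq = contradiction eq (punchInᵢ≢i k _)
pos-injective (k ∷ σ) (suc i) (suc j) eq = cong suc (pos-injective σ i j (punchIn-injective k _ _ eq))

pos-surjective : ∀ (σ : Shuffle n) j → ∃ λ i → pos σ i ≡ j
pos-surjective (k ∷ σ) j with k Fin.≟ j
... | yes k≡j = zero , k≡j
... | no  k≢j with pos-surjective σ (punchOut k≢j)
... | i , eq = suc i , trans (cong (punchIn k) eq) (punchIn-punchOut k≢j)

∈-act : ∀ (σ : Shuffle n) (p : Subset n) v → (v ∈ₛ act σ p) ⇔ (∃ λ u → u ∈ₛ p × pos σ u ≡ v)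
∈-act σ p v = mk⇔ to from
  where
  to : v ∈ₛ act σ p → ∃ λ u → u ∈ₛ p × pos σ u ≡ v
  to v∈ with pos-surjective σ v
  ... | u , refl = u , lookup⇒[]= u p (trans (sym (lookup-act σ p u)) ([]=⇒lookup v∈)) , refl
  from : (∃ λ u → u ∈ₛ p × pos σ u ≡ v) → v ∈ₛ act σ p
  from (u , u∈ , refl) = lookup⇒[]= _ _ (trans (lookup-act σ p u) ([]=⇒lookup u∈))

-- Every subset of the size of `p` is the image of `p` under the same number of permutations. By
-- induction, inserting the first coordinate contributes the factor from `insertions-inside` or
-- `insertions-outside`, which extends one of the two factorials.
∑-shuffles : ∀ (p : Subset n) f →
  ∑ (shuffles n) (λ σ → f (act σ p)) ≡ (∣ p ∣ ! * (n ∸ ∣ p ∣) !) * ∑ (subsets n ∣ p ∣) f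
∑-shuffles []      f = sym (+-identityʳ _)
∑-shuffles {suc n} (b ∷ p) f = begin
  ∑ (shuffles (suc n)) (λ σ → f (act σ (b ∷ p)))
    ≡⟨ ∑-cartesian _∷_ (allFin (suc n)) (shuffles n) _ ⟩
  ∑ (allFin (suc n)) (λ i → ∑ (shuffles n) (λ σ → f (insertAt (act σ p) i b)))
    ≡⟨ ∑-cong (allFin (suc n)) (λ i → ∑-shuffles p (λ q → f (insertAt q i b))) ⟩
  ∑ (allFin (suc n)) (λ i → K * ∑ (subsets n s) (λ q → f (insertAt q i b)))
    ≡⟨ ∑-*ˡ (allFin (suc n)) K _ ⟩
  K * insertions n s b f
    ≡⟨ last b ⟩
  (∣ b ∷ p ∣ ! * (suc n ∸ ∣ b ∷ p ∣) !) * ∑ (subsets (suc n) ∣ b ∷ p ∣) f ∎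
  where
  open ≡-Reasoning
  s = ∣ p ∣
  K = s ! * (n ∸ s) !
  last : ∀ b → K * insertions n s b f ≡ (∣ b ∷ p ∣ ! * (suc n ∸ ∣ b ∷ p ∣) !) * ∑ (subsets (suc n) ∣ b ∷ p ∣) f
  last true = trans (cong (K *_) (insertions-inside n s f))
    (solve 4 (λ a b s S → a :* b :* ((con 1 :+ s) :* S) := ((con 1 :+ s) :* a) :* b :* S) refl (s !) ((n ∸ s) !) s _)
  last false rewrite insertions-outside n s f | +-∸-assoc 1 (∣p∣≤n p) =
    solve 4 (λ a b d S → a :* b :* ((con 1 :+ d) :* S) := a :* ((con 1 :+ d) :* b) :* S) refl (s !) ((n ∸ s) !) (n ∸ s) _

-- The constant function 1 in `∑-shuffles` gives the number of permutations in a form that shares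
-- the factor `K` with the sums in `averaging`.
length-shuffles : ∀ n r (p : Subset n) → ∣ p ∣ ≡ r → length (shuffles n) ≡ (r ! * (n ∸ r) !) * (n C r)
length-shuffles n r p refl = begin
  length (shuffles n)                       ≡⟨ *-identityʳ _ ⟨
  length (shuffles n) * 1                   ≡⟨ ∑-const (shuffles n) 1 ⟨
  ∑ (shuffles n) (λ _ → 1)                  ≡⟨ ∑-shuffles p (λ _ → 1) ⟩
  K * ∑ (subsets n r) (λ _ → 1)             ≡⟨ cong (K *_) (trans (∑-const (subsets n r) 1) (trans (*-identityʳ _) (length-subsets n r))) ⟩
  K * (n C r)                               ∎
  where
  open ≡-Reasoning
  K = r ! * (n ∸ r) !

-- Over all permutations, each `E d` runs through all subsets of size `r` equally often. The sum
-- over permutations of the total weight of the moved family is therefore `length ps` times `K`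
-- times the sum of `f`, and pigeonhole picks a permutation above the average.
averaging : (f : Subset n → ℕ) (c : ℕ) (ps : List D) (E : D → Subset n) → (∀ {d} → d ∈ ps → ∣ E d ∣ ≡ r) →
            0 < length ps → c * (n C r) < ∑ (subsets n r) f →
            ∃ λ σ → length ps * c < ∑ ps (λ d → f (act σ (E d)))
averaging {n} {r = r} f c ps@(d₀ ∷ ds) E uniform _ lt with ∑-pigeonhole (length ps * c) (shuffles n) _ total
  where
  open ≤-Reasoning
  K = r ! * (n ∸ r) !
  instance
    K≢0 : NonZero K
    K≢0 = m*n≢0 (r !) ((n ∸ r) !) {{r !≢0}} {{(n ∸ r) !≢0}}
  each : ∀ d → d ∈ ps → ∑ (shuffles n) (λ σ → f (act σ (E d))) ≡ K * ∑ (subsets n r) f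
  each d d∈ with ∣ E d ∣ | uniform d∈ | ∑-shuffles (E d) f
  ... | _ | refl | eq = eq
  total : length (shuffles n) * (length ps * c) < ∑ (shuffles n) (λ σ → ∑ ps (λ d → f (act σ (E d))))
  total = begin-strict
    length (shuffles n) * (length ps * c)                          ≡⟨ cong (_* (length ps * c)) (length-shuffles n r (E d₀) (uniform (here refl))) ⟩
    (K * (n C r)) * (length ps * c)                                ≡⟨ solve 4 (λ K b l c → (K :* b) :* (l :* c) := l :* (K :* (c :* b))) refl K (n C r) (length ps) c ⟩
    length ps * (K * (c * (n C r)))                                <⟨ *-monoʳ-< (length ps) (*-monoʳ-< K lt) ⟩
    length ps * (K * ∑ (subsets n r) f)                            ≤⟨ ∑-≥ ps (λ d∈ → ≤-reflexive (sym (each _ d∈))) ⟩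
    ∑ ps (λ d → ∑ (shuffles n) (λ σ → f (act σ (E d))))            ≡⟨ ∑-swap ps (shuffles n) _ ⟩
    ∑ (shuffles n) (λ σ → ∑ ps (λ d → f (act σ (E d))))            ∎
... | σ , _ , _ , good = σ , good

-- Subsets from lists, unordered pairs, and indexing into lists.

toSubset : List (Fin n) → Subset n
toSubset = foldr (λ x p → p [ x ]≔ inside) ⊥

∈-toSubset⁺ : ∀ {x : Fin n} {xs} → x ∈ xs → x ∈ₛ toSubset xs
∈-toSubset⁺ {xs = y ∷ xs} (here refl) = []≔-updates (toSubset xs) y
∈-toSubset⁺ {x = x} {xs = y ∷ xs} (there x∈) with x Fin.≟ y
... | yes refl = []≔-updates (toSubset xs) y
... | no  x≢y  = []≔-minimal (toSubset xs) x y x≢y (∈-toSubset⁺ x∈)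

∈-toSubset⁻ : ∀ {x : Fin n} {xs} → x ∈ₛ toSubset xs → x ∈ xs
∈-toSubset⁻ {xs = []} x∈ = contradiction x∈ ∉⊥
∈-toSubset⁻ {x = x} {xs = y ∷ xs} x∈ with x Fin.≟ y
... | yes x≡y = here x≡y
... | no  x≢y = there (∈-toSubset⁻ (lookup⇒[]= x _ (trans (sym (lookup∘update′ x≢y (toSubset xs) inside)) ([]=⇒lookup x∈))))

∣≔inside∣ : ∀ (p : Subset n) x → x ∉ₛ p → ∣ p [ x ]≔ inside ∣ ≡ suc ∣ p ∣
∣≔inside∣ (true  ∷ p) zero    x∉ = contradiction here x∉
∣≔inside∣ (false ∷ p) zero    x∉ = refl
∣≔inside∣ (true  ∷ p) (suc x) x∉ = cong suc (∣≔inside∣ p x (x∉ ∘ there))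
∣≔inside∣ (false ∷ p) (suc x) x∉ = ∣≔inside∣ p x (x∉ ∘ there)

∣toSubset∣ : ∀ {xs : List (Fin n)} → Unique xs → ∣ toSubset xs ∣ ≡ length xs
∣toSubset∣ {n} []                     = ∣⊥∣≡0 n
∣toSubset∣ {xs = x ∷ xs} (x∉ ∷ u) = trans
  (∣≔inside∣ (toSubset xs) x (λ x∈ → All.lookup x∉ (∈-toSubset⁻ x∈) refl)) (cong suc (∣toSubset∣ u))

-- New vertices are indexed by ordered pairs, which makes the edge of {x , y} symmetric in x and y.
ordered : Fin n → Fin n → Fin n × Fin n
ordered x y with x Fin.<? y
... | yes _ = x , y
... | no  _ = y , x

ordered-cases : ∀ (x y : Fin n) → ordered x y ≡ (x , y) ⊎ ordered x y ≡ (y , x)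
ordered-cases x y with x Fin.<? y
... | yes _ = inj₁ refl
... | no  _ = inj₂ refl

ordered-sym : ∀ (x y : Fin n) → ordered x y ≡ ordered y x
ordered-sym x y with x Fin.<? y | y Fin.<? x
... | yes x<y | yes y<x = contradiction y<x (Fin.<-asym x<y)
... | yes _   | no  _   = refl
... | no  _   | yes _   = refl
... | no  x≮y | no  y≮x with Fin.<-cmp x y
... | tri< x<y _ _ = contradiction x<y x≮y
... | tri≈ _ refl _ = refl
... | tri> _ _ y<x = contradiction y<x y≮x

ordered-injective : ∀ {x y x′ y′ : Fin n} → ordered x y ≡ ordered x′ y′ →
                    (x ≡ x′ × y ≡ y′) ⊎ (x ≡ y′ × y ≡ x′)
ordered-injective {x = x} {y} {x′} {y′} eq with ordered-cases x y | ordered-cases x′ y′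
... | inj₁ p | inj₁ q = inj₁ (,-injective (trans (sym p) (trans eq q)))
... | inj₁ p | inj₂ q = inj₂ (,-injective (trans (sym p) (trans eq q)))
... | inj₂ p | inj₁ q = inj₂ (Product.swap (,-injective (trans (sym p) (trans eq q))))
... | inj₂ p | inj₂ q = inj₁ (Product.swap (,-injective (trans (sym p) (trans eq q))))

pairs-All : ∀ {R : A → A → Set} {xs} → AllPairs R xs → ∀ {x y} → (x , y) ∈ pairs xs → R x y
pairs-All {xs = x ∷ xs} (Rx ∷ Rxs) p∈ with ∈-++⁻ (map (x ,_) xs) p∈
... | inj₂ p∈ʳ = pairs-All Rxs p∈ʳ
... | inj₁ p∈ˡ with ∈-map⁻ (x ,_) p∈ˡ
... | y , y∈ , refl = All.lookup Rx y∈

lookup-pairs : ∀ (xs : List A) {i j} → i <ᶠ j → (lookup xs i , lookup xs j) ∈ pairs xs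
lookup-pairs (x ∷ xs) {zero}  {suc j} _         = ∈-++⁺ˡ (∈-map⁺ (x ,_) (∈-lookup {xs = xs} j))
lookup-pairs (x ∷ xs) {suc i} {suc j} (s≤s i<j) = ∈-++⁺ʳ (map (x ,_) xs) (lookup-pairs xs i<j)

lookup-injective : ∀ {xs : List A} → Unique xs → ∀ {i j} → lookup xs i ≡ lookup xs j → i ≡ j
lookup-injective {xs = xs} u {i} {j} eq with Fin.<-cmp i j
... | tri< i<j _ _ = contradiction eq (pairs-All u (lookup-pairs xs i<j))
... | tri≈ _ i≡j _ = i≡j
... | tri> _ _ j<i = contradiction (sym eq) (pairs-All u (lookup-pairs xs j<i))

Pair-≡ : ∀ {ℓ} {p q : Pair ℓ} → proj₁ p ≡ proj₁ q → p ≡ q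
Pair-≡ {p = ab , lt} {_ , lt′} refl = cong (ab ,_) (Fin.<-irrelevant lt lt′)

-- Double counting of edges and their colours.

length-filter-∑ : ∀ {P : A → Set} (P? : ∀ x → Dec (P x)) xs →
                  length (filter P? xs) ≡ ∑ xs (λ x → if does (P? x) then 1 else 0)
length-filter-∑ P? []       = refl
length-filter-∑ P? (x ∷ xs) with does (P? x)
... | true  = cong suc (length-filter-∑ P? xs)
... | false = length-filter-∑ P? xs

doubleCount : ∀ {R : A → B → Set} (R? : ∀ x y → Dec (R x y)) (xs : List A) (ys : List B) →
              ∑ xs (λ x → length (filter (R? x) ys)) ≡ ∑ ys (λ y → length (filter (λ x → R? x y) xs))
doubleCount R? xs ys = begin
  ∑ xs (λ x → length (filter (R? x) ys))                      ≡⟨ ∑-cong xs (λ x → length-filter-∑ (R? x) ys) ⟩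
  ∑ xs (λ x → ∑ ys (λ y → if does (R? x y) then 1 else 0))    ≡⟨ ∑-swap xs ys _ ⟩
  ∑ ys (λ y → ∑ xs (λ x → if does (R? x y) then 1 else 0))    ≡⟨ ∑-cong ys (λ y → length-filter-∑ (λ x → R? x y) xs) ⟨
  ∑ ys (λ y → length (filter (λ x → R? x y) xs))              ∎
  where open ≡-Reasoning

_∈?_ : (s : Subset n) (ss : List (Subset n)) → Dec (s ∈ ss)
_∈?_ = DecMembership._∈?_ (≡-dec Bool._≟_)

e≤filter : (H : RGraph r n) → e H ≤ length (filter (_∈? edges H) (subsets n r))
e≤filter {r} {n} H = unique⊆⇒length≤ (unique H) λ {s} s∈ →
  ∈-filter⁺ (_∈? edges H) (subst (λ r → s ∈ subsets n r) (All.lookup (uniform H) s∈) (∈-subsets s)) s∈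

e≤nCr : (H : RGraph r n) → e H ≤ n C r
e≤nCr {r} {n} H = ≤-trans (e≤filter H) (≤-trans (length-filter _ (subsets n r)) (≤-reflexive (length-subsets n r)))

module _ {k} (H : Fin k → RGraph r n) where

  colours : Subset n → List (Fin k)
  colours s = filter (λ i → s ∈? edges (H i)) (allFin k)

  sumEdges≤ : sumEdges H ≤ ∑ (subsets n r) (length ∘ colours)
  sumEdges≤ = ≤-trans (∑-mono (allFin k) (λ {i} _ → e≤filter (H i)))
    (≤-reflexive (doubleCount (λ i s → s ∈? edges (H i)) (allFin k) (subsets n r)))

  unique-colours : ∀ s → Unique (colours s)
  unique-colours s = Unique.filter⁺ _ (Unique.allFin⁺ k)

  length-colours≤ : ∀ s → length (colours s) ≤ k
  length-colours≤ s = ≤-trans (length-filter _ (allFin k)) (≤-reflexive (length-tabulate id))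

-- A fixed expansion of a large complete graph and its rainbow subcopies.

module Expansion (N r n : ℕ) (2≤r : 2 ≤ r) (fits : N + N * (N * (r ∸ 2)) ≤ n) where

  -- All `N * N` ordered pairs receive new vertices, so that `combine` can code them and `fits`
  -- compares `n` with a plain product.
  Vertex : Set
  Vertex = Fin N ⊎ ((Fin N × Fin N) × Fin (r ∸ 2))

  code : Vertex → Fin N ⊎ Fin (N * (N * (r ∸ 2)))
  code = Sum.map₂ λ ((x , y) , j) → combine x (combine y j)

  code-injective : ∀ u v → code u ≡ code v → u ≡ v
  code-injective (inj₁ x) (inj₁ y) eq = cong inj₁ (inj₁-injective eq)
  code-injective (inj₂ ((x , y) , j)) (inj₂ ((x′ , y′) , j′)) eq
    with combine-injective x (combine y j) x′ (combine y′ j′) (inj₂-injective eq)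
  ... | refl , eq′ with combine-injective y j y′ j′ eq′
  ... | refl , refl = refl

  ι : Vertex → Fin n
  ι v = inject≤ (join N _ (code v)) fits

  ι-injective : ∀ {u v} → ι u ≡ ι v → u ≡ v
  ι-injective {u} {v} eq = code-injective u v (begin
    code u                            ≡⟨ splitAt-join N _ (code u) ⟨
    splitAt N (join N _ (code u))     ≡⟨ cong (splitAt N) (inject≤-injective fits fits _ _ eq) ⟩
    splitAt N (join N _ (code v))     ≡⟨ splitAt-join N _ (code v) ⟩
    code v                            ∎)
    where open ≡-Reasoning

  edgeVertices : Fin N × Fin N → List Vertex
  edgeVertices (x , y) = inj₁ x ∷ inj₁ y ∷ map (λ j → inj₂ ((x , y) , j)) (allFin (r ∸ 2))

  edge : Fin N → Fin N → Subset n
  edge x y = toSubset (map ι (edgeVertices (ordered x y)))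

  edge-sym : ∀ x y → edge x y ≡ edge y x
  edge-sym x y = cong (toSubset ∘ map ι ∘ edgeVertices) (ordered-sym x y)

  unique-edgeVertices : ∀ {x y} → x ≢ y → Unique (edgeVertices (x , y))
  unique-edgeVertices {x} {y} x≢y =
    ((x≢y ∘ inj₁-injective) ∷ core) ∷ core ∷ Unique.map⁺ (λ { refl → refl }) (Unique.allFin⁺ (r ∸ 2))
    where
    core : ∀ {z} → All (inj₁ z ≢_) (map (λ j → inj₂ ((x , y) , j)) (allFin (r ∸ 2)))
    core = All.tabulate λ v∈ eq → no-core (subst (_∈ _) (sym eq) v∈)
      where
      no-core : ∀ {z} → inj₁ z ∉ map (λ j → inj₂ ((x , y) , j)) (allFin (r ∸ 2))
      no-core v∈ with ∈-map⁻ _ v∈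
      ... | _ , _ , ()

  ∣edge∣ : ∀ {x y} → x ≢ y → ∣ edge x y ∣ ≡ r
  ∣edge∣ {x} {y} x≢y = begin
    ∣ edge x y ∣                                      ≡⟨ ∣toSubset∣ (Unique.map⁺ ι-injective u) ⟩
    length (map ι (edgeVertices (ordered x y)))       ≡⟨ length-map ι (edgeVertices (ordered x y)) ⟩
    2 + length (map _ (allFin (r ∸ 2)))               ≡⟨ cong (2 +_) (trans (length-map _ (allFin (r ∸ 2))) (length-tabulate id)) ⟩
    2 + (r ∸ 2)                                       ≡⟨ m+[n∸m]≡n 2≤r ⟩
    r                                                 ∎
    where
    open ≡-Reasoning
    u : Unique (edgeVertices (ordered x y))
    u with ordered-cases x y
    ... | inj₁ eq = subst (Unique ∘ edgeVertices) (sym eq) (unique-edgeVertices x≢y)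
    ... | inj₂ eq = subst (Unique ∘ edgeVertices) (sym eq) (unique-edgeVertices (x≢y ∘ sym))

  -- The copy is the part of the fixed expansion spanned by `vs`, moved by `σ`. The order of `vs`
  -- may disagree with that of `Fin N`, so `ψ` sends the new vertices of an index pair to those of
  -- its ends after `ordered`.
  rainbow : ∀ {k} (H : Fin k → RGraph r n) (σ : Shuffle n) (vs : List (Fin N)) → Unique vs →
            (c : Fin N × Fin N → Fin k) →
            (∀ {p} → p ∈ pairs vs → c p ∈ colours H (act σ (uncurry edge p))) →
            (∀ {p q} → p ∈ pairs vs → q ∈ pairs vs → c p ≡ c q → p ≡ q) →
            RainbowExpansionK r (length vs) H
  rainbow {k} H σ vs u c c∈ c-inj =
    (λ t → pos σ (ι (ψ t))) , (λ p → c (ends p)) ,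
    (λ s t eq → ψ-injective s t (ι-injective (pos-injective σ _ _ eq))) ,
    (λ p q eq → ends-injective p q (c-inj (ends∈ p) (ends∈ q) eq)) ,
    λ p → act σ (uncurry edge (ends p)) ,
          proj₂ (∈-filter⁻ (λ i → _ ∈? edges (H i)) {xs = allFin k} (c∈ (ends∈ p))) ,
          λ v → mk⇔ (to p v) (from p v)
    where
    ℓ = length vs
    ends : Pair ℓ → Fin N × Fin N
    ends ((a , b) , _) = lookup vs a , lookup vs b

    ends∈ : ∀ p → ends p ∈ pairs vs
    ends∈ (_ , a<b) = lookup-pairs vs a<b

    ends-injective : ∀ p q → ends p ≡ ends q → proj₁ p ≡ proj₁ q
    ends-injective p q eq with ,-injective eq
    ... | eq₁ , eq₂ = cong₂ _,_ (lookup-injective u eq₁) (lookup-injective u eq₂)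

    ψ : ExpVertex r ℓ → Vertex
    ψ (inj₁ a)       = inj₁ (lookup vs a)
    ψ (inj₂ (p , j)) = inj₂ (uncurry ordered (ends p) , j)

    ψ-injective : ∀ s t → ψ s ≡ ψ t → s ≡ t
    ψ-injective (inj₁ a) (inj₁ b) eq = cong inj₁ (lookup-injective u (inj₁-injective eq))
    ψ-injective (inj₂ (p@((a , b) , a<b) , i)) (inj₂ (q@((a′ , b′) , a′<b′) , j)) eq
      with ,-injective (inj₂-injective eq)
    ... | eq′ , refl with ordered-injective eq′
    ... | inj₁ (eq₁ , eq₂) = cong (λ p → inj₂ (p , i)) (Pair-≡ (cong₂ _,_ (lookup-injective u eq₁) (lookup-injective u eq₂)))
    -- Both index pairs are increasing, so neither can be the reversal of the other.
    ... | inj₂ (eq₁ , eq₂) with lookup-injective u eq₁ | lookup-injective u eq₂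
    ... | refl | refl = contradiction a<b (Fin.<-asym a′<b′)

    to′ : ∀ p {z} → z ∈ edgeVertices (uncurry ordered (ends p)) → ∃ λ t → InExpEdge {r} p t × ψ t ≡ z
    to′ p@((a , b) , _) (here refl) with ordered-cases (lookup vs a) (lookup vs b)
    ... | inj₁ eq = inj₁ a , inj₁ refl , cong (inj₁ ∘ proj₁) (sym eq)
    ... | inj₂ eq = inj₁ b , inj₂ refl , cong (inj₁ ∘ proj₁) (sym eq)
    to′ p@((a , b) , _) (there (here refl)) with ordered-cases (lookup vs a) (lookup vs b)
    ... | inj₁ eq = inj₁ b , inj₂ refl , cong (inj₁ ∘ proj₂) (sym eq)
    ... | inj₂ eq = inj₁ a , inj₁ refl , cong (inj₁ ∘ proj₂) (sym eq)
    to′ p (there (there z∈)) with ∈-map⁻ _ z∈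
    ... | j , _ , refl = inj₂ (p , j) , refl , refl

    from′ : ∀ p t → InExpEdge {r} p t → ψ t ∈ edgeVertices (uncurry ordered (ends p))
    from′ p@((a , b) , _) (inj₁ _) (inj₁ refl) with ordered-cases (lookup vs a) (lookup vs b)
    ... | inj₁ eq = here (cong (inj₁ ∘ proj₁) (sym eq))
    ... | inj₂ eq = there (here (cong (inj₁ ∘ proj₂) (sym eq)))
    from′ p@((a , b) , _) (inj₁ _) (inj₂ refl) with ordered-cases (lookup vs a) (lookup vs b)
    ... | inj₁ eq = there (here (cong (inj₁ ∘ proj₂) (sym eq)))
    ... | inj₂ eq = here (cong (inj₁ ∘ proj₁) (sym eq))
    from′ p (inj₂ (q , j)) refl = there (there (∈-map⁺ _ (∈-allFin j)))

    to : ∀ p v → v ∈ₛ act σ (uncurry edge (ends p)) → Σ (ExpVertex r ℓ) λ t → InExpEdge {r} p t × pos σ (ι (ψ t)) ≡ v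
    to p v v∈ with Equivalence.to (∈-act σ _ v) v∈
    ... | w , w∈ , refl with ∈-map⁻ ι (∈-toSubset⁻ w∈)
    ... | z , z∈ , refl with to′ p z∈
    ... | t , t∈ , refl = t , t∈ , refl

    from : ∀ p v → (Σ (ExpVertex r ℓ) λ t → InExpEdge {r} p t × pos σ (ι (ψ t)) ≡ v) → v ∈ₛ act σ (uncurry edge (ends p))
    from p v (t , t∈ , refl) = Equivalence.from (∈-act σ _ v)
      (ι (ψ t) , ∈-toSubset⁺ (∈-map⁺ ι (from′ p t t∈)) , refl)

-- The upper bound when there are at least C(ℓ,2) colours.

trimmedSize coreSize : ℕ → ℕ → ℕ
trimmedSize ℓ k = ℓ + ℓ * (ℓ * k)
coreSize ℓ k = trimmedSize ℓ k + tri (trimmedSize ℓ k) * k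

-- More than `trimmedSize` vertices allow a clique to grow to size `ℓ`; `coreSize` vertices ensure
-- that more than `trimmedSize` survive pruning. The threshold makes room for the fixed expansion on
-- `coreSize` core vertices.
threshold : ℕ → ℕ → ℕ → ℕ
threshold ℓ r k = let N = coreSize ℓ k in N + N * (N * (r ∸ 2))

manyColours-upperBound : ∀ ℓ r c g → 2 ≤ r → 2 ≤ ℓ → tri ℓ ≡ suc c → 0 < c → g ≤ c →
        (∀ s → suc s < ℓ → g + s * (suc c + g) ≤ suc s * c) →
        ∀ N → coreSize ℓ (suc c + g) ≤ N →
        ∀ n → N + N * (N * (r ∸ 2)) ≤ n → (H : Fin (suc c + g) → RGraph r n) →
        ¬ RainbowExpansionK r ℓ H → sumEdges H ≤ c * (n C r)
manyColours-upperBound ℓ r c g 2≤r 2≤ℓ triℓ c>0 g≤c room N core≤N n large H none =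
  ≮⇒≥ λ dense → find-rainbow (averaging f c ps (uncurry edge) (λ p∈ → ∣edge∣ (pairs-All (Unique.allFin⁺ N) p∈)) ps>0
                       (<-≤-trans dense (sumEdges≤ H)))
  where
  k = suc c + g
  open Expansion N r n 2≤r large
  f : Subset n → ℕ
  f = length ∘ colours H
  xs = allFin N
  ps = pairs xs
  length-xs : length xs ≡ N
  length-xs = length-tabulate id
  2≤N : 2 ≤ N
  2≤N = ≤-trans 2≤ℓ (≤-trans (≤-trans (m≤m+n ℓ _) (m≤m+n (trimmedSize ℓ k) _)) core≤N)
  tri>0 : ∀ {m} → 2 ≤ m → 0 < tri m
  tri>0 (s≤s (s≤s _)) = s≤s z≤n
  ps>0 : 0 < length ps
  ps>0 = subst (0 <_) (sym (trans (length-pairs xs) (cong tri length-xs))) (tri>0 2≤N)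
  find-rainbow : (∃ λ σ → length ps * c < ∑ ps (λ p → f (act σ (uncurry edge p)))) → _
  find-rainbow (σ , heavy) = none (fromClique (heavyClique xs (Unique.allFin⁺ N) 2≤ℓ g≤c
      (subst (λ m → m * c < weight w xs) (length-pairs xs) heavy)
      (≤-trans core≤N (≤-reflexive (sym length-xs)))))
    where
    w : Fin N → Fin N → ℕ
    w x y = f (act σ (edge x y))
    open WeightedGraph w (λ x y → cong (f ∘ act σ) (edge-sym x y)) c k (λ x y → length-colours≤ H (act σ (edge x y)))
    open Grow ℓ g c>0 room
    palette : Fin N × Fin N → List (Fin k)
    palette p = colours H (act σ (uncurry edge p))
    fromClique : HeavyClique → RainbowExpansionK r ℓ H
    fromClique (vs , u , size , low , heavy′) = subst (λ ℓ → RainbowExpansionK r ℓ H) size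
      (rainbow H σ vs u (proj₁ sdr) (proj₁ (proj₂ sdr)) (proj₂ (proj₂ sdr)))
      where
      -- `zero` is the default colour for pairs outside the clique; it exists because `k` is a
      -- successor.
      sdr = heavySDR (×-≡-dec Fin._≟_ Fin._≟_) Fin._≟_ palette (λ p → unique-colours H (act σ (uncurry edge p))) zero
        c g (pairs vs) (trans (length-pairs vs) (trans (cong tri size) triℓ))
        (λ {p} p∈ → pairs-All low p∈) (λ p → length-colours≤ H (act σ (uncurry edge p)))
        (subst (λ m → m * c < ∑ (pairs vs) (length ∘ palette)) triℓ heavy′)

-- The extremal construction.

complete : RGraph r n
complete {r} {n} = record
  { edges = subsets n r ; unique = unique-subsets n r ; uniform = All.tabulate (∣subsets∣ n r) }

empty : RGraph r n
empty = record { edges = [] ; unique = [] ; uniform = [] }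

firstComplete : ∀ c {k} → Fin k → RGraph r n
firstComplete c i = if toℕ i <ᵇ c then complete else empty

sumEdges-firstComplete : ∀ c k → sumEdges (firstComplete {r} {n} c {k}) ≡ (k ⊓ c) * (n C r)
sumEdges-firstComplete {r} {n} c k = trans (∑-cong (allFin k) size) (count k c)
  where
  size : ∀ i → e (firstComplete {r} {n} c {k} i) ≡ (if toℕ i <ᵇ c then n C r else 0)
  size i with toℕ i <ᵇ c
  ... | true  = length-subsets n r
  ... | false = refl
  count : ∀ k c → ∑ (allFin k) (λ i → if toℕ i <ᵇ c then n C r else 0) ≡ (k ⊓ c) * (n C r)
  count zero    c       = refl
  count (suc k) zero    = trans (∑-const (allFin (suc k)) 0) (*-zeroʳ (length (allFin (suc k))))
  count (suc k) (suc c) = trans (∑-allFin-suc k _) (cong (n C r +_) (count k c))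

∈-firstComplete : ∀ c {k} (i : Fin k) {s} → s ∈ edges (firstComplete {r} {n} c i) → toℕ i < c
∈-firstComplete c i s∈ with toℕ i <ᵇ c in eq
... | true = <ᵇ⇒< (toℕ i) c (subst T (sym eq) _)
∈-firstComplete c i () | false

indexPairs : ∀ ℓ → List (Pair ℓ)
indexPairs zero    = []
indexPairs (suc ℓ) = map (λ j → (zero , suc j) , s≤s z≤n) (allFin ℓ) ++
                     map (λ ((a , b) , a<b) → (suc a , suc b) , s≤s a<b) (indexPairs ℓ)

length-indexPairs : ∀ ℓ → length (indexPairs ℓ) ≡ tri ℓ
length-indexPairs zero    = refl
length-indexPairs (suc ℓ) = trans (length-++ (map _ (allFin ℓ))) (cong₂ _+_
  (trans (length-map _ (allFin ℓ)) (length-tabulate id)) (trans (length-map _ (indexPairs ℓ)) (length-indexPairs ℓ)))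

unique-indexPairs : ∀ ℓ → Unique (indexPairs ℓ)
unique-indexPairs zero    = []
unique-indexPairs (suc ℓ) = Unique.++⁺
  (Unique.map⁺ (λ { refl → refl }) (Unique.allFin⁺ ℓ))
  (Unique.map⁺ (λ { refl → refl }) (unique-indexPairs ℓ))
  λ (p∈ , q∈) → disjoint (∈-map⁻ _ p∈) (∈-map⁻ _ q∈)
  where
  disjoint : ∀ {p} → (∃ λ j → j ∈ allFin ℓ × p ≡ ((zero , suc j) , s≤s z≤n)) →
             ¬ (∃ λ q → q ∈ indexPairs ℓ × p ≡ ((suc (proj₁ (proj₁ q)) , suc (proj₂ (proj₁ q))) , s≤s (proj₂ q)))
  disjoint (_ , _ , refl) (_ , _ , ())

-- Only colours below `c` have edges, while a rainbow copy would use `tri ℓ` distinct colours.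
firstComplete-rainbowFree : ∀ ℓ c {k} → c < tri ℓ → ¬ RainbowExpansionK r ℓ (firstComplete {r} {n} c {k})
firstComplete-rainbowFree {r} {n} ℓ c c<m (φ , col , _ , col-inj , edge) = <⇒≱ c<m (begin
  tri ℓ                                          ≡⟨ length-indexPairs ℓ ⟨
  length (indexPairs ℓ)                          ≡⟨ length-map (toℕ ∘ col) (indexPairs ℓ) ⟨
  length (map (toℕ ∘ col) (indexPairs ℓ))        ≤⟨ unique⊆⇒length≤ (Unique.map⁺ (Pair-≡ ∘ col-inj _ _ ∘ Fin.toℕ-injective) (unique-indexPairs ℓ)) small ⟩
  length (upTo c)                                ≡⟨ length-upTo c ⟩
  c                                              ∎)
  where
  open ≤-Reasoning
  small : ∀ {i} → i ∈ map (toℕ ∘ col) (indexPairs ℓ) → i ∈ upTo c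
  small i∈ with ∈-map⁻ _ i∈
  ... | p , _ , refl = ∈-upTo⁺ (∈-firstComplete c (col p) (proj₁ (proj₂ (edge p))))

-- Arithmetic of the parameters and the conclusion.

tri≡C2 : ∀ ℓ → tri ℓ ≡ ℓ C 2
tri≡C2 zero    = refl
tri≡C2 (suc ℓ) = trans (cong₂ _+_ (sym (nC1≡n ℓ)) (tri≡C2 ℓ)) (nCk+nC[k+1]≡[n+1]C[k+1] ℓ 1)

2*tri : ∀ ℓ → 2 * tri (suc ℓ) ≡ suc ℓ * ℓ
2*tri zero    = refl
2*tri (suc ℓ) = begin
  2 * (suc ℓ + tri (suc ℓ))        ≡⟨ *-distribˡ-+ 2 (suc ℓ) _ ⟩
  2 * suc ℓ + 2 * tri (suc ℓ)      ≡⟨ cong (2 * suc ℓ +_) (2*tri ℓ) ⟩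
  2 * suc ℓ + suc ℓ * ℓ            ≡⟨ solve 1 (λ l → con 2 :* (con 1 :+ l) :+ (con 1 :+ l) :* l := (con 2 :+ l) :* (con 1 :+ l)) refl ℓ ⟩
  suc (suc ℓ) * suc ℓ              ∎
  where open ≡-Reasoning

-- Put L for `suc ℓ`. Since 2·C(L,2) = L² - L, the bound on the number of colours leaves 2g < L - 1,
-- which for integers is 2(g + 1) ≤ L.
few-extra-colours : ∀ ℓ c g → tri (suc ℓ) ≡ suc c → 2 * (suc c + g) < suc ℓ * suc ℓ ∸ 1 → 2 * suc g ≤ suc ℓ
few-extra-colours ℓ c g tri≡ few = +-cancelˡ-≤ (2 * suc c) _ _ (begin
  2 * suc c + 2 * suc g              ≡⟨ solve 2 (λ c g → con 2 :* c :+ con 2 :* (con 1 :+ g) := con 2 :+ con 2 :* (c :+ g)) refl (suc c) g ⟩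
  2 + 2 * (suc c + g)                ≤⟨ s≤s few ⟩
  suc ℓ * suc ℓ                      ≡⟨ solve 1 (λ l → (con 1 :+ l) :* (con 1 :+ l) := (con 1 :+ l) :* l :+ (con 1 :+ l)) refl ℓ ⟩
  suc ℓ * ℓ + suc ℓ                  ≡⟨ cong (_+ suc ℓ) (trans (sym (2*tri ℓ)) (cong (2 *_) tri≡)) ⟩
  2 * suc c + suc ℓ                  ∎)
  where open ≤-Reasoning

-- The inequality rearranges to (s + 1)(g + 1) ≤ c + 1. After doubling, the right side is the
-- product of `suc ℓ` and `ℓ`, and these bound 2(g + 1) and s + 1 respectively.
room : ∀ ℓ c g → tri (suc ℓ) ≡ suc c → 2 * suc g ≤ suc ℓ → ∀ s → suc s ≤ ℓ → g + s * (suc c + g) ≤ suc s * c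
room ℓ c g tri≡ 2g≤ℓ s s<ℓ = +-cancelˡ-≤ 1 _ _ (begin
  suc (g + s * (suc c + g))          ≡⟨ solve 3 (λ s c g → con 1 :+ (g :+ s :* (con 1 :+ c :+ g)) := s :* c :+ (con 1 :+ s) :* (con 1 :+ g)) refl s c g ⟩
  s * c + suc s * suc g              ≤⟨ +-monoʳ-≤ (s * c) (*-cancelˡ-≤ 2 twice) ⟩
  s * c + suc c                      ≡⟨ solve 2 (λ s c → s :* c :+ (con 1 :+ c) := con 1 :+ (con 1 :+ s) :* c) refl s c ⟩
  suc (suc s * c)                    ∎)
  where
  open ≤-Reasoning
  twice : 2 * (suc s * suc g) ≤ 2 * suc c
  twice = begin
    2 * (suc s * suc g)      ≡⟨ solve 2 (λ s g → con 2 :* (s :* g) := (con 2 :* g) :* s) refl (suc s) (suc g) ⟩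
    (2 * suc g) * suc s      ≤⟨ *-mono-≤ 2g≤ℓ s<ℓ ⟩
    suc ℓ * ℓ                ≡⟨ 2*tri ℓ ⟨
    2 * tri (suc ℓ)          ≡⟨ cong (2 *_) tri≡ ⟩
    2 * suc c                ∎

upperBound : ∀ ℓ r k c → 3 ≤ r → 3 ≤ ℓ → 2 * k < ℓ * ℓ ∸ 1 → tri ℓ ≡ suc c →
             ∀ n → threshold ℓ r k ≤ n → (H : Fin k → RGraph r n) → ¬ RainbowExpansionK r ℓ H →
             sumEdges H ≤ (k ⊓ c) * (n C r)
upperBound (suc ℓ) r k c 3≤r 3≤ℓ few tri≡ n large H none with k ≤? c
... | yes k≤c = begin
  sumEdges H                          ≤⟨ ∑-≤ (allFin k) (λ {i} _ → e≤nCr (H i)) ⟩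
  length (allFin k) * (n C r)         ≡⟨ cong (_* (n C r)) (length-tabulate {n = k} id) ⟩
  k * (n C r)                         ≡⟨ cong (_* (n C r)) (m≤n⇒m⊓n≡m k≤c) ⟨
  (k ⊓ c) * (n C r)                   ∎
  where open ≤-Reasoning
-- The surplus of `k` over `suc c` becomes `g`.
... | no k≰c with m≤n⇒∃[o]m+o≡n (≰⇒> k≰c)
... | g , refl rewrite m≥n⇒m⊓n≡n (≰⇒≥ k≰c) =
  manyColours-upperBound (suc ℓ) r c g (<⇒≤ 3≤r) (<⇒≤ 3≤ℓ) tri≡ c>0 g≤c (λ s → room′ s ∘ ≤-pred) (coreSize (suc ℓ) (suc c + g)) ≤-refl n large H none
  where
  room′ = room ℓ c g tri≡ (few-extra-colours ℓ c g tri≡ few)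
  2≤tri : ∀ {m} → 3 ≤ m → 2 ≤ tri m
  2≤tri (s≤s (s≤s (s≤s _))) = s≤s (s≤s z≤n)
  c>0 : 0 < c
  c>0 = ≤-pred (subst (2 ≤_) tri≡ (2≤tri 3≤ℓ))
  g≤c : g ≤ c
  g≤c = subst₂ _≤_ (+-identityʳ g) (+-identityʳ c) (room′ 0 (≤-pred (<⇒≤ 3≤ℓ)))

theorem1p12 : (ℓ r k : ℕ) → 3 ≤ r → r ≤ ℓ → 1 ≤ k → 2 * k < ℓ * ℓ ∸ 1 →
    Σ ℕ λ n₀ → (n : ℕ) → n₀ ≤ n →
    (Σ (Fin k → RGraph r n) λ H →
    ¬ RainbowExpansionK r ℓ H × sumEdges H ≡ (k ⊓ (ℓ C 2 ∸ 1)) * (n C r))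
    × ((H : Fin k → RGraph r n) → ¬ RainbowExpansionK r ℓ H →
    sumEdges H ≤ (k ⊓ (ℓ C 2 ∸ 1)) * (n C r))
theorem1p12 ℓ r k 3≤r r≤ℓ _ few = threshold ℓ r k , λ n large →
  (firstComplete c , firstComplete-rainbowFree ℓ c (≤-reflexive (sym tri≡)) , sumEdges-firstComplete c k) ,
  upperBound ℓ r k c 3≤r 3≤ℓ few tri≡ n large
  where
  c = ℓ C 2 ∸ 1
  3≤ℓ = ≤-trans 3≤r r≤ℓ
  -- C(ℓ,2) is positive, so `∸ 1` in `c` is a true predecessor.
  tri>0 : ∀ {m} → 3 ≤ m → 1 ≤ tri m
  tri>0 (s≤s (s≤s _)) = s≤s z≤n
  tri≡ : tri ℓ ≡ suc c
  tri≡ = trans (tri≡C2 ℓ) (sym (m+[n∸m]≡n (subst (1 ≤_) (tri≡C2 ℓ) (tri>0 3≤ℓ))))
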